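{- For every integer $k\ge 3$, the infinite product $D_k$ converges and $0<D_k<1$. Furthermore, for every integer $k\ge 3$ and every positive integer $n$, $\frac{1}{2k}<g_k(n)<2k$.
   Context: $p$ always denotes a prime. For positive integers $k,n$: $\delta_k(x)=\dfrac{(x-1)^{k}+k(x-1)^{k-1}+(-1)^{k}(k-1)}{x}$. $D_k=\prod_{p}\dfrac{\delta_k(p)}{p^{k-1}}$, the product being over all primes $p$. $g_k(n)=\prod_{p\mid n}\left(1+\dfrac{(-1)^{k-1}(k-1)}{\delta_k(p)}\right)$, the product being over the primes $p$ dividing $n$ (empty product equal to $1$). -}

module Defs where

open import Data.Integer as ℤ using (ℤ; +_; 1ℤ; -1ℤ)
import Data.Integer.Properties as ℤ
open import Data.List using (List; filter; foldr; map; mapMaybe; upTo)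
open import Data.Maybe as Maybe using ()
open import Data.Nat as ℕ using (ℕ; suc; NonZero; _∸_)
open import Data.Nat.Divisibility using (_∣?_)
open import Data.Nat.Primality using (Prime; prime?; prime⇒nonZero; prime⇒nonTrivial)
import Data.Nat.Properties as ℕ
open import Data.Product using (∃; ∃-syntax; _×_; _,_)
open import Data.Rational as ℚ using (ℚ; 0ℚ; 1ℚ; _/_; _÷_; ∣_∣)
import Data.Rational.Properties as ℚ
open import Data.Sum using (_⊎_; inj₁; inj₂)
open import Relation.Binary.PropositionalEquality
open import Relation.Nullary.Decidable using (dec⇒maybe)

Cauchy : (ℕ → ℚ) → Set
Cauchy s = ∀ ε → 0ℚ ℚ.< ε →
  ∃[ N ] (∀ m n → N ℕ.≤ m → N ℕ.≤ n → ∣ s m ℚ.- s n ∣ ℚ.< ε)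

-- Reals as Cauchy sequences of rationals; equality of reals is not _≡_.
record ℝ : Set where
  constructor mkℝ
  field
    seq    : ℕ → ℚ
    cauchy : Cauchy seq

open ℝ public

infix 4 _<ℝ_ _⟶_

-- The uniform gap ε makes this the strict order of the limits; eventual
-- termwise strict inequality would only give the weak order.
_<ℝ_ : ℝ → ℝ → Set
x <ℝ y = ∃[ ε ] (0ℚ ℚ.< ε × ∃[ N ] (∀ n → N ℕ.≤ n → seq x n ℚ.+ ε ℚ.≤ seq y n))

fromℚ : ℚ → ℝ
fromℚ q = mkℝ (λ _ → q) λ ε 0<ε →
  0 , λ _ _ _ _ → subst (ℚ._< ε) (sym (cong ∣_∣ (ℚ.+-inverseʳ q))) 0<ε

-- The two inequalities say ∣ s n - x ∣ < ε.
_⟶_ : (ℕ → ℚ) → ℝ → Set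
s ⟶ x = ∀ ε → 0ℚ ℚ.< ε → ∃[ N ] (∀ n → N ℕ.≤ n →
  fromℚ (s n ℚ.- ε) <ℝ x × x <ℝ fromℚ (s n ℚ.+ ε))

primes≤ : ℕ → List (∃ Prime)
primes≤ N = mapMaybe (λ p → Maybe.map (p ,_) (dec⇒maybe (prime? p))) (upTo (suc N))

∏ : List (∃ Prime) → (∀ p → Prime p → ℚ) → ℚ
∏ ps f = foldr ℚ._*_ 1ℚ (map (λ (p , pr) → f p pr) ps)

δ-num : ℕ → ℕ → ℤ
δ-num k x =
  (+ x ℤ.- 1ℤ) ℤ.^ k
    ℤ.+ + k ℤ.* (+ x ℤ.- 1ℤ) ℤ.^ (k ∸ 1)
    ℤ.+ -1ℤ ℤ.^ k ℤ.* (+ k ℤ.- 1ℤ)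

δ : (k x : ℕ) → .{{NonZero k}} → .{{NonZero x}} → ℚ
δ k x = δ-num k x / x

private
  pos-^ : ∀ m n → (+ m) ℤ.^ n ≡ + (m ℕ.^ n)
  pos-^ m ℕ.zero  = refl
  pos-^ m (suc n) =
    trans (cong (+ m ℤ.*_) (pos-^ m n)) (sym (ℤ.pos-* m (m ℕ.^ n)))

  -1^n≡±1 : ∀ n → -1ℤ ℤ.^ n ≡ 1ℤ ⊎ -1ℤ ℤ.^ n ≡ -1ℤ
  -1^n≡±1 ℕ.zero = inj₁ refl
  -1^n≡±1 (suc n) with -1^n≡±1 n
  ... | inj₁ eq = inj₂ (cong (-1ℤ ℤ.*_) eq)
  ... | inj₂ eq = inj₁ (cong (-1ℤ ℤ.*_) eq)

  m<n⇒0<n-m : ∀ {m n} → m ℕ.< n → ℤ.0ℤ ℤ.< + n ℤ.- + m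
  m<n⇒0<n-m {m} {n} m<n
    rewrite ℤ.m-n≡m⊖n n m | ℤ.⊖-≥ (ℕ.<⇒≤ m<n) = ℤ.+<+ (ℕ.m<n⇒0<n∸m m<n)

  δ-num>0 : ∀ k x → .{{NonZero k}} → .{{ℕ.NonTrivial x}} → ℤ.0ℤ ℤ.< δ-num k x
  δ-num>0 k@(suc j) (suc (suc q))
    rewrite pos-^ (suc q) k | pos-^ (suc q) j
          | sym (ℤ.pos-* k (suc q ℕ.^ j))
    with -1ℤ ℤ.^ k | -1^n≡±1 k
  ... | _ | inj₁ refl rewrite ℤ.*-identityˡ (+ j) =
    ℤ.+<+ (ℕ.≤-trans (ℕ.m^n>0 (suc q) k)
      (ℕ.≤-trans (ℕ.m≤m+n _ _) (ℕ.m≤m+n _ j)))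
  ... | _ | inj₂ refl rewrite ℤ.-1*i≡-i (+ j) =
    m<n⇒0<n-m (ℕ.≤-trans (ℕ.m≤m*n k (suc q ℕ.^ j) {{ℕ.m^n≢0 (suc q) j}})
      (ℕ.m≤n+m _ (suc q ℕ.^ k)))

  >0⇒/-positive : ∀ i n .{{_ : NonZero n}} → ℤ.0ℤ ℤ.< i → ℚ.Positive (i / n)
  >0⇒/-positive (+ suc m) n _ = ℚ.normalize-pos (suc m) n
  >0⇒/-positive (+ 0) n (ℤ.+<+ ())

δ-positive : ∀ k p → .{{_ : NonZero k}} → .{{_ : NonZero p}} → Prime p →
             ℚ.Positive (δ k p)
δ-positive k p pr = >0⇒/-positive (δ-num k p) p (δ-num>0 k p)
  where instance _ = prime⇒nonTrivial pr

module _ (k : ℕ) .{{_ : NonZero k}} where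

  D-factor : ∀ p → Prime p → ℚ
  D-factor p pr = δ k p ℚ.* (1ℤ / p ℕ.^ (k ∸ 1))
    where instance
      _ = prime⇒nonZero pr
      _ = ℕ.m^n≢0 p (k ∸ 1)

  -- Dₖ is the limit of these as N → ∞.
  D-partial : ℕ → ℚ
  D-partial N = ∏ (primes≤ N) D-factor

  g-factor : ∀ p → Prime p → ℚ
  g-factor p pr = 1ℚ ℚ.+ ((-1ℤ ℤ.^ (k ∸ 1) ℤ.* (+ k ℤ.- 1ℤ)) / 1) ÷ δ k p
    where instance
      _ = prime⇒nonZero pr
      _ = ℚ.pos⇒nonZero (δ k p) {{δ-positive k p pr}}

  -- For positive n, every prime divisor of n is at most n.
  g : (n : ℕ) → .{{NonZero n}} → ℚ
  g n = ∏ (filter (λ (p , _) → p ∣? n) (primes≤ n)) g-factor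

{-# OPTIONS --safe #-}
module Submission where

-- Put y = p - 1. Since p^k = (y + 1)^k, the number p δ_k(p) agrees with p^k in its
-- two top terms in y, so each factor of D_k lies in (0, 1) and is 1 - O(1/p²). For a
-- large constant c and all large p it is therefore at least η(p-1)/η(p), where
-- η(N) = N/(N + c). So the partial products decrease while their products with η
-- increase, which gives both convergence and a positive lower bound.
-- In g_k, the factor at 2 is k or 1/k, and the factor at an odd prime p lies between
-- 1/w and w, where w = p(p-1)/((p+1)(p-2)). Over all odd p ≥ 3 these weights telescope
-- to a product less than 2.

open import Defs
open import Algebra.Bundles using (CommutativeMonoid)
open import Data.Bool using (true; false; if_then_else_)
open import Data.Integer as ℤ using (+_; 1ℤ; -1ℤ)
import Data.Integer.Properties as ℤ
open import Data.List using ([]; _∷_; _∷ʳ_; _++_; catMaybes; filter; mapMaybe; upTo)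
import Data.List.Properties as List
open import Data.Maybe as Maybe using ()
open import Data.Nat as ℕ using (ℕ; NonZero; zero; suc; _≤_; _*_; s≤s; z≤n; _^_)
open import Data.Nat.Divisibility using (_∣?_; divides)
open import Data.Nat.Primality using (Prime; prime?; prime[2]; ¬prime[1]; prime⇒irreducible)
import Data.Nat.Properties as ℕ
open import Data.Nat.Properties using (m*n≢0)
open import Data.Nat.Tactic.RingSolver using (solve-∀)
open import Data.Product using (∃-syntax; _×_; _,_; proj₁; proj₂)
open import Data.Rational as ℚ using (ℚ; 0ℚ; 1ℚ; ½; _/_; _<_; _÷_; ∣_∣)
import Data.Rational.Properties as ℚ
open import Data.Rational.Solver using (module +-*-Solver)
open import Data.Rational.Unnormalised as ℚᵘ using (mkℚᵘ)
import Data.Rational.Unnormalised.Properties as ℚᵘ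
open import Data.Sum using (_⊎_; inj₁; inj₂)
open import Relation.Binary.PropositionalEquality
open import Relation.Nullary using (¬_; contradiction; does; yes; no)
open import Relation.Nullary.Decidable using (dec⇒maybe)
open import Relation.Unary using (Decidable)
open import Algebra.Properties.CommutativeSemigroup
  (CommutativeMonoid.commutativeSemigroup ℚ.*-1-commutativeMonoid) using (interchange)

-- Fractions of integers

/-cross-≡ : ∀ a b c d .{{_ : NonZero b}} .{{_ : NonZero d}} →
            a * d ≡ c * b → + a / b ≡ + c / d
/-cross-≡ a (suc b) c (suc d) eq = ℚ.fromℚᵘ-cong {mkℚᵘ (+ a) b} {mkℚᵘ (+ c) d}
  (ℚᵘ.*≡* (trans (sym (ℤ.pos-* a (suc d))) (trans (cong +_ eq) (ℤ.pos-* c (suc b)))))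

/-cross-≤ : ∀ a b c d .{{_ : NonZero b}} .{{_ : NonZero d}} →
            a * d ≤ c * b → + a / b ℚ.≤ + c / d
/-cross-≤ a (suc b) c (suc d) le = ℚ.toℚᵘ-cancel-≤ (begin
  ℚ.toℚᵘ (ℚ.fromℚᵘ (mkℚᵘ (+ a) b)) ≃⟨ ℚ.toℚᵘ-fromℚᵘ (mkℚᵘ (+ a) b) ⟩
  mkℚᵘ (+ a) b ≤⟨ ℚᵘ.*≤* (subst₂ ℤ._≤_ (ℤ.pos-* a (suc d)) (ℤ.pos-* c (suc b)) (ℤ.+≤+ le)) ⟩
  mkℚᵘ (+ c) d ≃⟨ ℚᵘ.≃-sym (ℚ.toℚᵘ-fromℚᵘ (mkℚᵘ (+ c) d)) ⟩
  ℚ.toℚᵘ (ℚ.fromℚᵘ (mkℚᵘ (+ c) d)) ∎)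
  where open ℚᵘ.≤-Reasoning

/-cross-< : ∀ a b c d .{{_ : NonZero b}} .{{_ : NonZero d}} →
            a * d ℕ.< c * b → + a / b < + c / d
/-cross-< a (suc b) c (suc d) lt = ℚ.toℚᵘ-cancel-< (begin-strict
  ℚ.toℚᵘ (ℚ.fromℚᵘ (mkℚᵘ (+ a) b)) ≃⟨ ℚ.toℚᵘ-fromℚᵘ (mkℚᵘ (+ a) b) ⟩
  mkℚᵘ (+ a) b <⟨ ℚᵘ.*<* (subst₂ ℤ._<_ (ℤ.pos-* a (suc d)) (ℤ.pos-* c (suc b)) (ℤ.+<+ lt)) ⟩
  mkℚᵘ (+ c) d ≃⟨ ℚᵘ.≃-sym (ℚ.toℚᵘ-fromℚᵘ (mkℚᵘ (+ c) d)) ⟩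
  ℚ.toℚᵘ (ℚ.fromℚᵘ (mkℚᵘ (+ c) d)) ∎)
  where open ℚᵘ.≤-Reasoning

/-* : ∀ i j m n .{{_ : NonZero m}} .{{_ : NonZero n}} →
      (i / m) ℚ.* (j / n) ≡ _/_ (i ℤ.* j) (m * n) {{m*n≢0 m n}}
/-* i j m@(suc m-1) n@(suc n-1) = ℚ.toℚᵘ-injective (begin
  ℚ.toℚᵘ ((i / m) ℚ.* (j / n)) ≈⟨ ℚ.toℚᵘ-homo-* (i / m) (j / n) ⟩
  ℚ.toℚᵘ (i / m) ℚᵘ.* ℚ.toℚᵘ (j / n)
    ≈⟨ ℚᵘ.*-cong (ℚ.toℚᵘ-fromℚᵘ (mkℚᵘ i m-1)) (ℚ.toℚᵘ-fromℚᵘ (mkℚᵘ j n-1)) ⟩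
  mkℚᵘ i m-1 ℚᵘ.* mkℚᵘ j n-1 ≈⟨ ℚᵘ.≃-sym (ℚ.toℚᵘ-fromℚᵘ _) ⟩
  ℚ.toℚᵘ ((i ℤ.* j) / (m * n)) ∎)
  where open ℚᵘ.≃-Reasoning

/-+ : ∀ i j n .{{_ : NonZero n}} → (i / n) ℚ.+ (j / n) ≡ (i ℤ.+ j) / n
/-+ i j n@(suc n-1) = ℚ.toℚᵘ-injective (begin
  ℚ.toℚᵘ ((i / n) ℚ.+ (j / n)) ≈⟨ ℚ.toℚᵘ-homo-+ (i / n) (j / n) ⟩
  ℚ.toℚᵘ (i / n) ℚᵘ.+ ℚ.toℚᵘ (j / n)
    ≈⟨ ℚᵘ.+-cong (ℚ.toℚᵘ-fromℚᵘ (mkℚᵘ i n-1)) (ℚ.toℚᵘ-fromℚᵘ (mkℚᵘ j n-1)) ⟩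
  mkℚᵘ i n-1 ℚᵘ.+ mkℚᵘ j n-1 ≈⟨ ℚᵘ.*≡* eq ⟩
  mkℚᵘ (i ℤ.+ j) n-1 ≈⟨ ℚᵘ.≃-sym (ℚ.toℚᵘ-fromℚᵘ (mkℚᵘ (i ℤ.+ j) n-1)) ⟩
  ℚ.toℚᵘ ((i ℤ.+ j) / n) ∎)
  where
  open ℚᵘ.≃-Reasoning
  eq : (i ℤ.* + n ℤ.+ j ℤ.* + n) ℤ.* + n ≡ (i ℤ.+ j) ℤ.* (+ (n * n))
  eq = trans (cong (ℤ._* + n) (sym (ℤ.*-distribʳ-+ (+ n) i j)))
             (trans (ℤ.*-assoc (i ℤ.+ j) (+ n) (+ n))
                    (cong ((i ℤ.+ j) ℤ.*_) (sym (ℤ.pos-* n n))))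

-- Inverses are unique, so an explicit inverse can replace `1/ q`; applied with δ_k(p) = a/p and its
-- inverse p/a.
÷-inverse : ∀ x q r .{{_ : ℚ.NonZero q}} → q ℚ.* r ≡ 1ℚ → x ÷ q ≡ x ℚ.* r
÷-inverse x q r qr≡1 = cong (x ℚ.*_) (begin
  ℚ.1/ q                    ≡⟨ ℚ.*-identityʳ _ ⟨
  (ℚ.1/ q) ℚ.* 1ℚ           ≡⟨ cong ((ℚ.1/ q) ℚ.*_) qr≡1 ⟨
  (ℚ.1/ q) ℚ.* (q ℚ.* r)    ≡⟨ ℚ.*-assoc (ℚ.1/ q) q r ⟨
  (ℚ.1/ q) ℚ.* q ℚ.* r      ≡⟨ cong (ℚ._* r) (ℚ.*-inverseˡ q) ⟩
  1ℚ ℚ.* r                  ≡⟨ ℚ.*-identityˡ r ⟩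
  r                         ∎)
  where open ≡-Reasoning

-- The expansion of (y + 1)^k and the numerator of δ_k

-- The two top terms of the expansion of (y + 1)^k for k = j + 1. The numerator of δ_k(y + 1) is
-- this plus or minus j.
lead : ℕ → ℕ → ℕ
lead y j = y ^ suc j ℕ.+ suc j * y ^ j

-- The terms of degree ≤ j - 1 in y in the expansion of (y + 1) ^ (j + 1).
excess : ℕ → ℕ → ℕ
excess y zero    = 0
excess y (suc j) = suc y * excess y j ℕ.+ suc j * y ^ j

-- Multiplying `lead y j` by y + 1 gives `lead y (suc j)` and the spill-over (j + 1) y^j, which is
-- the term that the recursion of `excess` adds.
lead+excess : ∀ y j → lead y j ℕ.+ excess y j ≡ suc y ^ suc j
lead+excess y zero    = base y
  where
  base : ∀ y → y * 1 ℕ.+ 1 * 1 ℕ.+ 0 ≡ suc y * 1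
  base = solve-∀
lead+excess y (suc j) =
  trans (step y j (y ^ j) (excess y j)) (cong (suc y *_) (lead+excess y j))
  where
  step : ∀ y j t e →
    y * (y * t) ℕ.+ suc (suc j) * (y * t) ℕ.+ (suc y * e ℕ.+ suc j * t) ≡
    suc y * (y * t ℕ.+ suc j * t ℕ.+ e)
  step = solve-∀

-- With k = i + 2 this is k² p^(k-2), two degrees below p^k: the source of 1 - O(1/p²). In the
-- induction m² + m stays below (m + 1)².
excess-upper : ∀ y i → excess y (suc i) ≤ (2 ℕ.+ i) * (2 ℕ.+ i) * suc y ^ i
excess-upper y zero    = subst (_≤ 4) (sym (cong (ℕ._+ 1) (ℕ.*-zeroʳ y))) (s≤s z≤n)
excess-upper y (suc i) = begin
  suc y * excess y (suc i) ℕ.+ m * y ^ suc i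
    ≤⟨ ℕ.+-mono-≤ (ℕ.*-monoʳ-≤ (suc y) (excess-upper y i))
                  (ℕ.*-monoʳ-≤ m (ℕ.^-monoˡ-≤ (suc i) (ℕ.n≤1+n y))) ⟩
  suc y * (m * m * suc y ^ i) ℕ.+ m * suc y ^ suc i
    ≤⟨ ℕ.m≤m+n _ (suc m * suc y ^ suc i) ⟩
  suc y * (m * m * suc y ^ i) ℕ.+ m * suc y ^ suc i ℕ.+ suc m * suc y ^ suc i
    ≡⟨ square (suc y) m (suc y ^ i) ⟩
  suc m * suc m * suc y ^ suc i ∎
  where
  open ℕ.≤-Reasoning
  m = 2 ℕ.+ i
  square : ∀ p m t → p * (m * m * t) ℕ.+ m * (p * t) ℕ.+ suc m * (p * t) ≡
                     suc m * suc m * (p * t)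
  square = solve-∀

-- Room for the j that an even k adds to `lead`. For k = 2 the excess is only 1 = j, so k ≥ 3 enters
-- here.
excess-lower : ∀ y .{{_ : NonZero y}} i → 2 ℕ.+ i ℕ.< excess y (2 ℕ.+ i)
excess-lower y@(suc z) zero = ℕ.≤-trans (ℕ.m≤m+n 3 (suc z ℕ.+ z ℕ.+ z)) (ℕ.≤-reflexive (expand z))
  where
  expand : ∀ z → 3 ℕ.+ (suc z ℕ.+ z ℕ.+ z) ≡
    suc (suc z) * (suc (suc z) * 0 ℕ.+ 1 * 1) ℕ.+ 2 * (suc z * 1)
  expand = solve-∀
excess-lower y@(suc z) (suc i) = begin
  4 ℕ.+ i                                        ≤⟨ s≤s (excess-lower y i) ⟩
  1 ℕ.+ excess y (2 ℕ.+ i)                       ≡⟨ ℕ.+-comm 1 _ ⟩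
  excess y (2 ℕ.+ i) ℕ.+ 1
    ≤⟨ ℕ.+-mono-≤ (ℕ.m≤n*m (excess y (2 ℕ.+ i)) (suc y))
                  (ℕ.≤-trans (ℕ.m^n>0 y (2 ℕ.+ i)) (ℕ.m≤n*m (y ^ (2 ℕ.+ i)) (3 ℕ.+ i))) ⟩
  suc y * excess y (2 ℕ.+ i) ℕ.+ (3 ℕ.+ i) * y ^ (2 ℕ.+ i) ∎
  where open ℕ.≤-Reasoning

n<2^n : ∀ n → n ℕ.< 2 ^ n
n<2^n zero    = s≤s z≤n
n<2^n (suc n) = begin-strict
  suc n         ≤⟨ n<2^n n ⟩
  2 ^ n         <⟨ ℕ.m<m+n (2 ^ n) (ℕ.m^n>0 2 n) ⟩
  2 ^ n ℕ.+ 2 ^ n ≡⟨ cong (2 ^ n ℕ.+_) (ℕ.+-identityʳ (2 ^ n)) ⟨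
  2 ^ suc n     ∎
  where open ℕ.≤-Reasoning

-- An equality at i = 0. For larger i the left side grows by the factor (i + 2)/2 ≤ i + 1 only, and
-- y^i ≥ 2^i > i covers it.
lead-lower : ∀ y i → 2 ≤ y → (2 ℕ.+ i) * (y * y * (3 ℕ.+ y)) ≤ 2 * lead y (2 ℕ.+ i)
lead-lower y i 2≤y = begin
  (2 ℕ.+ i) * c                ≤⟨ ℕ.m≤m+n _ (i * c) ⟩
  (2 ℕ.+ i) * c ℕ.+ i * c      ≡⟨ double i c ⟩
  2 * (suc i * c)
    ≤⟨ ℕ.*-monoʳ-≤ 2 (ℕ.*-monoˡ-≤ c (ℕ.≤-trans (n<2^n i) (ℕ.^-monoˡ-≤ i 2≤y))) ⟩
  2 * (y ^ i * c)              ≤⟨ ℕ.*-monoʳ-≤ 2 (ℕ.m≤m+n (y ^ i * c) (i * (y * (y * y ^ i)))) ⟩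
  2 * (y ^ i * c ℕ.+ i * (y * (y * y ^ i))) ≡⟨ cong (2 *_) (expand y i (y ^ i)) ⟩
  2 * lead y (2 ℕ.+ i)         ∎
  where
  open ℕ.≤-Reasoning
  c = y * y * (3 ℕ.+ y)
  double : ∀ i c → (2 ℕ.+ i) * c ℕ.+ i * c ≡ 2 * (suc i * c)
  double = solve-∀
  expand : ∀ y i t → t * (y * y * (3 ℕ.+ y)) ℕ.+ i * (y * (y * t)) ≡
                     y * (y * (y * t)) ℕ.+ (3 ℕ.+ i) * (y * (y * t))
  expand = solve-∀

pos-^ : ∀ m n → (+ m) ℤ.^ n ≡ + (m ^ n)
pos-^ m zero    = refl
pos-^ m (suc n) = trans (cong (+ m ℤ.*_) (pos-^ m n)) (sym (ℤ.pos-* m (m ^ n)))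

-1^n≡±1 : ∀ n → -1ℤ ℤ.^ n ≡ 1ℤ ⊎ -1ℤ ℤ.^ n ≡ -1ℤ
-1^n≡±1 zero = inj₁ refl
-1^n≡±1 (suc n) with -1^n≡±1 n
... | inj₁ eq = inj₂ (cong (-1ℤ ℤ.*_) eq)
... | inj₂ eq = inj₁ (cong (-1ℤ ℤ.*_) eq)

j<lead : ∀ y .{{_ : NonZero y}} j → j ℕ.< lead y j
j<lead y j = ℕ.≤-trans (ℕ.m≤m*n (suc j) (y ^ j) {{ℕ.m^n≢0 y j}}) (ℕ.m≤n+m _ (y ^ suc j))

-- a is (y + 1) δ_k(y + 1) for k = j + 1; the constructors are named after the parity of k.
data Numerator (j y a : ℕ) : Set where
  odd-k  : -1ℤ ℤ.^ j ≡ 1ℤ → a ℕ.+ j ≡ lead y j → Numerator j y a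
  even-k : -1ℤ ℤ.^ j ≡ -1ℤ → a ≡ lead y j ℕ.+ j → Numerator j y a

-- As k = j + 1, the last term of `δ-num` has the sign opposite to (-1)^j. Where j is subtracted,
-- `j<lead` keeps the truncated subtraction exact.
δ-num-natural : ∀ j y .{{_ : NonZero y}} →
  ∃[ a ] (δ-num (suc j) (suc y) ≡ + a × Numerator j y a)
δ-num-natural j y with -1^n≡±1 j
... | inj₁ eq = a , num , odd-k eq (ℕ.m∸n+n≡m (ℕ.<⇒≤ (j<lead y j)))
  where
  a = lead y j ℕ.∸ j
  num : δ-num (suc j) (suc y) ≡ + a
  num rewrite pos-^ y (suc j) | pos-^ y j | eq | sym (ℤ.pos-* (suc j) (y ^ j))
            | ℤ.-1*i≡-i (+ j) =
    trans (ℤ.m-n≡m⊖n (lead y j) j) (ℤ.⊖-≥ (ℕ.<⇒≤ (j<lead y j)))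
... | inj₂ eq = lead y j ℕ.+ j , num , even-k eq refl
  where
  num : δ-num (suc j) (suc y) ≡ + (lead y j ℕ.+ j)
  num rewrite pos-^ y (suc j) | pos-^ y j | eq | sym (ℤ.pos-* (suc j) (y ^ j))
            | ℤ.*-identityˡ (+ j) = refl

numerator-positive : ∀ {j y a} .{{_ : NonZero y}} .{{_ : NonZero j}} → Numerator j y a → 0 ℕ.< a
numerator-positive {j} {y} (odd-k _ a+j≡lead) =
  ℕ.+-cancelʳ-< j 0 _ (subst (j ℕ.<_) (sym a+j≡lead) (j<lead y j))
numerator-positive {j} {y} (even-k _ refl) =
  ℕ.≤-trans (s≤s z≤n) (ℕ.≤-trans (j<lead y j) (ℕ.m≤m+n _ j))

numerator-upper : ∀ {i y a} .{{_ : NonZero y}} → Numerator (2 ℕ.+ i) y a → a ℕ.< suc y ^ (3 ℕ.+ i)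
numerator-upper {i} {y} {a} num = begin-strict
  a                                        ≤⟨ a≤lead+j num ⟩
  lead y (2 ℕ.+ i) ℕ.+ (2 ℕ.+ i)           <⟨ ℕ.+-monoʳ-< _ (excess-lower y i) ⟩
  lead y (2 ℕ.+ i) ℕ.+ excess y (2 ℕ.+ i)  ≡⟨ lead+excess y (2 ℕ.+ i) ⟩
  suc y ^ (3 ℕ.+ i)                        ∎
  where
  open ℕ.≤-Reasoning
  a≤lead+j : Numerator (2 ℕ.+ i) y a → a ≤ lead y (2 ℕ.+ i) ℕ.+ (2 ℕ.+ i)
  a≤lead+j (odd-k _ eq)  = ℕ.≤-trans (ℕ.m≤m+n a _) (ℕ.≤-trans (ℕ.≤-reflexive eq) (ℕ.m≤m+n _ _))
  a≤lead+j (even-k _ eq) = ℕ.≤-reflexive eq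

-- With k = i + 3: k² bounds the excess and k absorbs the term j, so that a factor of D_k is at
-- least 1 - `deficit i` / p².
deficit : ℕ → ℕ
deficit i = (3 ℕ.+ i) * (3 ℕ.+ i) ℕ.+ (3 ℕ.+ i)

numerator-lower : ∀ {i y a} → Numerator (2 ℕ.+ i) y a →
  suc y ^ (3 ℕ.+ i) ≤ a ℕ.+ deficit i * suc y ^ suc i
numerator-lower {i} {y} {a} num = begin
  suc y ^ (3 ℕ.+ i)                        ≡⟨ lead+excess y j ⟨
  lead y j ℕ.+ excess y j                  ≤⟨ ℕ.+-mono-≤ (lead≤a+j num) (excess-upper y (suc i)) ⟩
  a ℕ.+ j ℕ.+ m * m * t                    ≤⟨ ℕ.+-monoˡ-≤ _ (ℕ.+-monoʳ-≤ a j≤mt) ⟩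
  a ℕ.+ m * t ℕ.+ m * m * t                ≡⟨ regroup a m t ⟩
  a ℕ.+ deficit i * t                      ∎
  where
  open ℕ.≤-Reasoning
  j = 2 ℕ.+ i
  m = 3 ℕ.+ i
  t = suc y ^ suc i
  j≤mt : j ≤ m * t
  j≤mt = ℕ.≤-trans (ℕ.n≤1+n j) (ℕ.m≤m*n m t {{ℕ.m^n≢0 (suc y) (suc i)}})
  lead≤a+j : Numerator j y a → lead y j ≤ a ℕ.+ j
  lead≤a+j (odd-k _ eq)   = ℕ.≤-reflexive (sym eq)
  lead≤a+j (even-k _ refl) = ℕ.≤-trans (ℕ.m≤m+n _ j) (ℕ.m≤m+n _ j)
  regroup : ∀ a m t → a ℕ.+ m * t ℕ.+ m * m * t ≡ a ℕ.+ (m * m ℕ.+ m) * t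
  regroup = solve-∀

-- Clears denominators in y / (y + c) ≤ (a / p^k) (p / (p + c)), where p = y + 1.
numerator-telescope : ∀ {i y a} → deficit i * deficit i ≤ suc y → Numerator (2 ℕ.+ i) y a →
  let c = suc (deficit i) in
  y * (suc y ^ (3 ℕ.+ i) * (c ℕ.+ suc y)) ≤ a * suc y * (c ℕ.+ y)
numerator-telescope {i} {y} {a} d²≤p num = ℕ.+-cancelʳ-≤ (c * P) _ _ (begin
  -- Adding c P completes the product: y (c + p) + c = p (c + y).
  y * (P * (c ℕ.+ suc y)) ℕ.+ c * P        ≡⟨ collect y P c ⟩
  P * e                                    ≤⟨ ℕ.*-monoˡ-≤ e (numerator-lower num) ⟩
  (a ℕ.+ d * t) * e                        ≡⟨ split a d t (suc y) (c ℕ.+ y) ⟩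
  a * suc y * (c ℕ.+ y) ℕ.+ suc y * t * (d * (c ℕ.+ y))
    ≤⟨ ℕ.+-monoʳ-≤ _ (ℕ.*-monoʳ-≤ (suc y * t) bound) ⟩
  a * suc y * (c ℕ.+ y) ℕ.+ suc y * t * (c * suc y)
    ≡⟨ cong (a * suc y * (c ℕ.+ y) ℕ.+_) (swap (suc y) t c) ⟩
  a * suc y * (c ℕ.+ y) ℕ.+ c * P          ∎)
  where
  open ℕ.≤-Reasoning
  d = deficit i
  c = suc d
  t = suc y ^ suc i
  P = suc y ^ (3 ℕ.+ i)
  e = suc y * (c ℕ.+ y)
  collect : ∀ y P c → y * (P * (c ℕ.+ suc y)) ℕ.+ c * P ≡ P * (suc y * (c ℕ.+ y))
  collect = solve-∀
  split : ∀ a d t p e → (a ℕ.+ d * t) * (p * e) ≡ a * p * e ℕ.+ p * t * (d * e)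
  split = solve-∀
  swap : ∀ p t c → p * t * (c * p) ≡ c * (p * (p * t))
  swap = solve-∀
  -- The choice c = d + 1 leaves one spare p on the right, which has to pay for d²; hence the
  -- threshold d² ≤ p.
  bound : d * (c ℕ.+ y) ≤ c * suc y
  bound = begin
    d * (suc d ℕ.+ y)            ≡⟨ expand d y ⟩
    d * d ℕ.+ d * suc y          ≤⟨ ℕ.+-monoˡ-≤ _ d²≤p ⟩
    c * suc y                    ∎
    where
    expand : ∀ d y → d * (suc d ℕ.+ y) ≡ d * d ℕ.+ d * suc y
    expand = solve-∀

-- The factors of D_k and g_k as single fractions

/-*ˡ : ∀ i j n .{{_ : NonZero n}} → (i / 1) ℚ.* (j / n) ≡ (i ℤ.* j) / n
/-*ˡ i j n = trans (/-* i j 1 n)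
                   (ℚ./-cong {p₁ = i ℤ.* j} {{ℕ.m*n≢0 1 n}} refl (ℕ.*-identityˡ n))

module _ {j y a : ℕ} (eq : δ-num (suc j) (suc y) ≡ + a) (pr : Prime (suc y)) where

  private p = suc y

  D-factor-fraction : .{{_ : NonZero (p ^ suc j)}} → D-factor (suc j) p pr ≡ + a / p ^ suc j
  D-factor-fraction = begin
    δ (suc j) p ℚ.* _/_ 1ℤ (p ^ j) {{ℕ.m^n≢0 p j}}
      ≡⟨ cong (λ n → n / p ℚ.* _/_ 1ℤ (p ^ j) {{ℕ.m^n≢0 p j}}) eq ⟩
    + a / p ℚ.* _/_ 1ℤ (p ^ j) {{ℕ.m^n≢0 p j}}
      ≡⟨ /-* (+ a) 1ℤ p (p ^ j) {{_}} {{ℕ.m^n≢0 p j}} ⟩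
    (+ a ℤ.* 1ℤ) / p ^ suc j
      ≡⟨ cong (_/ p ^ suc j) (ℤ.*-identityʳ (+ a)) ⟩
    + a / p ^ suc j ∎
    where open ≡-Reasoning

  -- From δ_k(p) = a/p the factor is (a + (-1)^j j p)/a. The numerator stays an integer here because
  -- each parity of k identifies it with a natural in its own way.
  g-factor-fraction : ∀ {b} .{{_ : NonZero a}} →
    + a ℤ.+ -1ℤ ℤ.^ j ℤ.* + j ℤ.* + p ≡ + b → g-factor (suc j) p pr ≡ + b / a
  g-factor-fraction {b} eqb = begin
    g-factor (suc j) p pr
      ≡⟨ cong (1ℚ ℚ.+_) (÷-inverse ((σ ℤ.* + j) / 1) (δ (suc j) p) (+ p / a)
           {{ℚ.pos⇒nonZero (δ (suc j) p) {{δ-positive (suc j) p pr}}}} inverse) ⟩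
    1ℚ ℚ.+ ((σ ℤ.* + j) / 1) ℚ.* (+ p / a)
      ≡⟨ cong₂ ℚ._+_ (/-cross-≡ 1 1 a a (ℕ.*-comm 1 a)) (/-*ˡ (σ ℤ.* + j) (+ p) a) ⟩
    + a / a ℚ.+ (σ ℤ.* + j ℤ.* + p) / a
      ≡⟨ /-+ (+ a) (σ ℤ.* + j ℤ.* + p) a ⟩
    (+ a ℤ.+ σ ℤ.* + j ℤ.* + p) / a
      ≡⟨ cong (_/ a) eqb ⟩
    + b / a ∎
    where
    open ≡-Reasoning
    σ = -1ℤ ℤ.^ j
    inverse : δ (suc j) p ℚ.* (+ p / a) ≡ 1ℚ
    inverse = begin
      δ-num (suc j) p / p ℚ.* (+ p / a)  ≡⟨ cong (λ n → n / p ℚ.* (+ p / a)) eq ⟩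
      + a / p ℚ.* (+ p / a)              ≡⟨ /-* (+ a) (+ p) p a ⟩
      _/_ (+ a ℤ.* + p) (p * a) {{ℕ.m*n≢0 p a}}
        ≡⟨ cong (λ n → _/_ n (p * a) {{ℕ.m*n≢0 p a}}) (sym (ℤ.pos-* a p)) ⟩
      _/_ (+ (a * p)) (p * a) {{ℕ.m*n≢0 p a}}
        ≡⟨ /-cross-≡ (a * p) (p * a) 1 1 {{ℕ.m*n≢0 p a}} (cross a p) ⟩
      1ℚ ∎
      where
      cross : ∀ a p → a * p * 1 ≡ 1 * (p * a)
      cross = solve-∀

-- Products over primes

∏-++ : ∀ ps qs f → ∏ (ps ++ qs) f ≡ ∏ ps f ℚ.* ∏ qs f
∏-++ []              qs f = sym (ℚ.*-identityˡ _)
∏-++ ((p , pr) ∷ ps) qs f =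
  trans (cong (f p pr ℚ.*_) (∏-++ ps qs f)) (sym (ℚ.*-assoc (f p pr) (∏ ps f) (∏ qs f)))

-- Moves the divisibility test from the list into the factor. Then `g` is a product over all primes
-- up to a bound, and induction on the bound can keep n fixed.
∏-filter : ∀ {ℓ} {P : ℕ → Set ℓ} (P? : Decidable P) ps f →
  ∏ (filter (λ (p , _) → P? p) ps) f ≡ ∏ ps (λ p pr → if does (P? p) then f p pr else 1ℚ)
∏-filter P? []              f = refl
∏-filter P? ((p , pr) ∷ ps) f with P? p
... | yes _ = cong (f p pr ℚ.*_) (∏-filter P? ps f)
... | no  _ = trans (∏-filter P? ps f) (sym (ℚ.*-identityˡ _))

-- An induction step for arbitrary predicates, so that later arguments never unfold the list of
-- primes.
∏-primes≤-suc : ∀ f N (P : ℚ → Set) →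
  (∀ pr → P (∏ (primes≤ N) f ℚ.* f (suc N) pr)) → (¬ Prime (suc N) → P (∏ (primes≤ N) f)) →
  P (∏ (primes≤ (suc N)) f)
∏-primes≤-suc f N P prime-case other-case = subst P (sym split) (last (prime? (suc N)))
  where
  open ≡-Reasoning
  pick = λ p → Maybe.map (p ,_) (dec⇒maybe (prime? p))
  -- Takes the primality decision as an argument, so that `last` can match on it.
  tail = λ d → catMaybes (Maybe.map (suc N ,_) (dec⇒maybe d) ∷ [])
  split : ∏ (primes≤ (suc N)) f ≡ ∏ (primes≤ N) f ℚ.* ∏ (tail (prime? (suc N))) f
  split = begin
    ∏ (mapMaybe pick (upTo (2 ℕ.+ N))) f
      ≡⟨ cong (λ ns → ∏ (mapMaybe pick ns) f) (List.upTo-∷ʳ (suc N)) ⟨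
    ∏ (mapMaybe pick (upTo (suc N) ∷ʳ suc N)) f
      ≡⟨ cong (λ ps → ∏ ps f) (List.mapMaybe-++ pick (upTo (suc N)) (suc N ∷ [])) ⟩
    ∏ (primes≤ N ++ mapMaybe pick (suc N ∷ [])) f
      ≡⟨ ∏-++ (primes≤ N) _ f ⟩
    ∏ (primes≤ N) f ℚ.* ∏ (tail (prime? (suc N))) f ∎
  last : ∀ d → P (∏ (primes≤ N) f ℚ.* ∏ (tail d) f)
  last (yes pr) = subst (λ q → P (∏ (primes≤ N) f ℚ.* q)) (sym (ℚ.*-identityʳ _)) (prime-case pr)
  last (no ¬pr) = subst P (sym (ℚ.*-identityʳ _)) (other-case ¬pr)

even-not-prime : ∀ i → ¬ Prime (4 ℕ.+ i * 2)
even-not-prime i pr with prime⇒irreducible pr (divides {2} (2 ℕ.+ i) refl)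
... | inj₁ ()
... | inj₂ ()

even-or-odd : ∀ m → ∃[ i ] (m ≡ i * 2 ⊎ m ≡ suc (i * 2))
even-or-odd zero = 0 , inj₁ refl
even-or-odd (suc m) with even-or-odd m
... | i , inj₁ refl = i , inj₂ refl
... | i , inj₂ refl = suc i , inj₁ refl

-- Bounds on g_k

-- For positive w this says 1/w ≤ q ≤ w.
Within : ℚ → ℚ → Set
Within w q = 1ℚ ℚ.≤ q ℚ.* w × q ℚ.≤ w

0<1 : 0ℚ < 1ℚ
0<1 = ℚ.positive⁻¹ 1ℚ

within⇒positive : ∀ {w q} .{{_ : ℚ.Positive w}} → Within w q → ℚ.Positive q
within⇒positive {w} {q} (1≤qw , _) = ℚ.positive (ℚ.*-cancelʳ-<-nonNeg w {{ℚ.pos⇒nonNeg w}} {0ℚ} {q}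
  (subst (_< q ℚ.* w) (sym (ℚ.*-zeroˡ w)) (ℚ.<-≤-trans 0<1 1≤qw)))

*-mono-≤-pos : ∀ {p q r s} .{{_ : ℚ.Positive q}} .{{_ : ℚ.Positive r}} →
  p ℚ.≤ q → r ℚ.≤ s → p ℚ.* r ℚ.≤ q ℚ.* s
*-mono-≤-pos {p} {q} {r} {s} p≤q r≤s =
  ℚ.≤-trans (ℚ.*-monoʳ-≤-nonNeg r {{ℚ.pos⇒nonNeg r}} p≤q)
            (ℚ.*-monoˡ-≤-nonNeg q {{ℚ.pos⇒nonNeg q}} r≤s)

within-* : ∀ {v w q r} .{{v>0 : ℚ.Positive v}} .{{_ : ℚ.Positive w}} →
  Within v q → Within w r → Within (v ℚ.* w) (q ℚ.* r)
within-* {v} {w} {q} {r} {{v>0}} q~v@(1≤qv , q≤v) r~w@(1≤rw , r≤w) =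
  subst (1ℚ ℚ.≤_) (interchange q v r w)
    (*-mono-≤-pos {1ℚ} {q ℚ.* v} {1ℚ} {r ℚ.* w} {{ℚ.positive (ℚ.<-≤-trans 0<1 1≤qv)}} 1≤qv 1≤rw) ,
  *-mono-≤-pos {q} {v} {r} {w} {{v>0}} {{within⇒positive r~w}} q≤v r≤w

within⇒< : ∀ {v w q} .{{_ : ℚ.Positive w}} → w < v → Within w q → 1ℚ < q ℚ.* v × q < v
within⇒< {v} {w} {q} w<v q~w@(1≤qw , q≤w) =
  ℚ.≤-<-trans 1≤qw (ℚ.*-monoʳ-<-pos q {{within⇒positive q~w}} w<v) , ℚ.≤-<-trans q≤w w<v

within-fractions : ∀ u v b a .{{_ : NonZero v}} .{{_ : NonZero a}} →
  v * a ≤ u * b → b * v ≤ u * a → Within (+ u / v) (+ b / a)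
within-fractions u v b a va≤ub bv≤ua =
  subst (1ℚ ℚ.≤_) (sym product)
    (/-cross-≤ 1 1 (b * u) (a * v) {{_}} {{ℕ.m*n≢0 a v}}
      (subst₂ _≤_ (unitˡ v a) (unitʳ u b) va≤ub)) ,
  /-cross-≤ b a u v bv≤ua
  where
  product : + b / a ℚ.* (+ u / v) ≡ _/_ (+ (b * u)) (a * v) {{ℕ.m*n≢0 a v}}
  product = trans (/-* (+ b) (+ u) a v)
    (cong (λ n → _/_ n (a * v) {{ℕ.m*n≢0 a v}}) (sym (ℤ.pos-* b u)))
  unitˡ : ∀ v a → v * a ≡ 1 * (a * v)
  unitˡ = solve-∀
  unitʳ : ∀ u b → u * b ≡ b * u * 1
  unitʳ = solve-∀

within-1 : ∀ u v .{{_ : NonZero v}} → v ≤ u → Within (+ u / v) 1ℚ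
within-1 u v v≤u = within-fractions u v 1 1 (ℕ.*-monoˡ-≤ 1 v≤u)
  (subst₂ _≤_ (sym (ℕ.*-identityˡ v)) (sym (ℕ.*-identityʳ u)) v≤u)

/-positive : ∀ a b .{{_ : NonZero a}} .{{_ : NonZero b}} → ℚ.Positive (+ a / b)
/-positive a b = ℚ.normalize-pos a b

-- With P = 2i + 1 this is 2P/(P + 1), the product of the weights `ω` over the odd numbers from 3 to
-- P; it is 1 at i = 0.
β : ℕ → ℚ
β i = + (2 * suc (i * 2)) / (2 ℕ.+ i * 2)

-- The weight w at p = z + 3; the shift keeps p - 2 positive.
ω : ℕ → ℚ
ω z = + ((3 ℕ.+ z) * (2 ℕ.+ z)) / ((4 ℕ.+ z) * suc z)

-- So w - 1 = 2/((p + 1)(p - 2)) and 1 - 1/w = 2/(p(p - 1)): the allowed deviation of a factor from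
-- 1 on either side.
ω-gap : ∀ z → (4 ℕ.+ z) * suc z ℕ.+ 2 ≡ (3 ℕ.+ z) * (2 ℕ.+ z)
ω-gap = solve-∀

ω-≥1 : ∀ z → (4 ℕ.+ z) * suc z ≤ (3 ℕ.+ z) * (2 ℕ.+ z)
ω-≥1 z = ℕ.≤-trans (ℕ.m≤m+n _ 2) (ℕ.≤-reflexive (ω-gap z))

within-ω-1 : ∀ z → Within (ω z) 1ℚ
within-ω-1 z = within-1 ((3 ℕ.+ z) * (2 ℕ.+ z)) ((4 ℕ.+ z) * suc z) (ω-≥1 z)

-- Over odd integers p = z + 3 the weights ω telescope.
β-step : ∀ i → β i ℚ.* ω (i * 2) ≡ β (suc i)
β-step i = trans (/-* (+ a) (+ c) b d) (trans (cong (λ n → _/_ n (b * d)) (sym (ℤ.pos-* a c)))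
  (/-cross-≡ (a * c) (b * d) (2 * suc (suc i * 2)) (2 ℕ.+ suc i * 2) (cross (i * 2))))
  where
  a = 2 * suc (i * 2)
  b = 2 ℕ.+ i * 2
  c = (3 ℕ.+ i * 2) * (2 ℕ.+ i * 2)
  d = (4 ℕ.+ i * 2) * suc (i * 2)
  cross : ∀ z → 2 * suc z * ((3 ℕ.+ z) * (2 ℕ.+ z)) * (4 ℕ.+ z) ≡
                2 * (3 ℕ.+ z) * ((2 ℕ.+ z) * ((4 ℕ.+ z) * suc z))
  cross = solve-∀

β-positive : ∀ i → ℚ.Positive (β i)
β-positive i = /-positive (2 * suc (i * 2)) (2 ℕ.+ i * 2)

ω-positive : ∀ z → ℚ.Positive (ω z)
ω-positive z = /-positive ((3 ℕ.+ z) * (2 ℕ.+ z)) ((4 ℕ.+ z) * suc z)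

β<2 : ∀ i → β i < + 2 / 1
β<2 i = /-cross-< (2 * suc (i * 2)) (2 ℕ.+ i * 2) 2 1
  (subst (ℕ._< 2 * (2 ℕ.+ i * 2)) (sym (ℕ.*-identityʳ (2 * suc (i * 2))))
    (ℕ.*-monoʳ-< 2 {suc (i * 2)} ℕ.≤-refl))

-- Products of factors bounded by the weights

module _ (f : ∀ p → Prime p → ℚ) {κ : ℚ} .{{κ>0 : ℚ.Positive κ}}
         (f-2 : ∀ pr → Within κ (f 2 pr))
         (f-odd : ∀ z pr → Within (ω z) (f (3 ℕ.+ z) pr))
         where

  private
    s : ℕ → ℚ
    s N = ∏ (primes≤ N) f

    κβ-positive : ∀ i → ℚ.Positive (κ ℚ.* β i)
    κβ-positive i = ℚ.pos*pos⇒pos κ (β i) {{β-positive i}}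

  -- The prime 2 costs κ. Every odd number from 3 on is charged its weight, prime or not, since 1
  -- also lies within `ω`; this keeps the product telescoping. Larger even numbers cost nothing.
  within-even : ∀ i → Within (κ ℚ.* β i) (s (2 ℕ.+ i * 2))
  within-odd  : ∀ i → Within (κ ℚ.* β (suc i)) (s (3 ℕ.+ i * 2))

  within-even zero = ∏-primes≤-suc f 1 (Within (κ ℚ.* β 0))
    (λ pr → subst₂ Within (sym (ℚ.*-identityʳ κ)) (sym (ℚ.*-identityˡ (f 2 pr))) (f-2 pr))
    (λ ¬pr → contradiction prime[2] ¬pr)
  within-even (suc i) = ∏-primes≤-suc f (3 ℕ.+ i * 2) (Within (κ ℚ.* β (suc i)))
    (λ pr → contradiction pr (even-not-prime i)) (λ _ → within-odd i)
  within-odd i = ∏-primes≤-suc f (2 ℕ.+ i * 2) (Within (κ ℚ.* β (suc i)))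
    (λ pr → step (f-odd (i * 2) pr))
    (λ _ → subst (Within _) (ℚ.*-identityʳ (s (2 ℕ.+ i * 2))) (step (within-ω-1 (i * 2))))
    where
    step : ∀ {q} → Within (ω (i * 2)) q → Within (κ ℚ.* β (suc i)) (s (2 ℕ.+ i * 2) ℚ.* q)
    step {q} q~ω = subst (λ w → Within w (s (2 ℕ.+ i * 2) ℚ.* q))
      (trans (ℚ.*-assoc κ (β i) (ω (i * 2))) (cong (κ ℚ.*_) (β-step i)))
      (within-* {{κβ-positive i}} {{ω-positive (i * 2)}} (within-even i) q~ω)

  ∏-primes≤-bounds : ∀ m → let N = 2 ℕ.+ m in
    1ℚ < s N ℚ.* (κ ℚ.* (+ 2 / 1)) × s N < κ ℚ.* (+ 2 / 1)
  ∏-primes≤-bounds m = bounds (even-or-odd m)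
    where
    bounds : ∀ {m} → ∃[ i ] (m ≡ i * 2 ⊎ m ≡ suc (i * 2)) →
      1ℚ < s (2 ℕ.+ m) ℚ.* (κ ℚ.* (+ 2 / 1)) × s (2 ℕ.+ m) < κ ℚ.* (+ 2 / 1)
    bounds (i , inj₁ refl) =
      within⇒< {{κβ-positive i}} (ℚ.*-monoʳ-<-pos κ (β<2 i)) (within-even i)
    bounds (i , inj₂ refl) =
      within⇒< {{κβ-positive (suc i)}} (ℚ.*-monoʳ-<-pos κ (β<2 (suc i))) (within-odd i)

-- The factors of g_k at 2 and at odd primes

within-if : ∀ {w q} b → Within w 1ℚ → Within w q → Within w (if b then q else 1ℚ)
within-if true  _ h = h
within-if false h _ = h

g-factor-odd-k : ∀ {j y a} .{{_ : NonZero a}} → δ-num (suc j) (suc y) ≡ + a →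
  -1ℤ ℤ.^ j ≡ 1ℤ → ∀ pr → g-factor (suc j) (suc y) pr ≡ + (a ℕ.+ j * suc y) / a
g-factor-odd-k {j} {y} {a} eq σ≡1 pr = g-factor-fraction {j} {y} {a} eq pr (begin
  + a ℤ.+ -1ℤ ℤ.^ j ℤ.* + j ℤ.* + suc y ≡⟨ cong (λ σ → + a ℤ.+ σ ℤ.* + j ℤ.* + suc y) σ≡1 ⟩
  + a ℤ.+ 1ℤ ℤ.* + j ℤ.* + suc y
    ≡⟨ cong (λ n → + a ℤ.+ n ℤ.* + suc y) (ℤ.*-identityˡ (+ j)) ⟩
  + a ℤ.+ + j ℤ.* + suc y               ≡⟨ cong (λ n → + a ℤ.+ n) (ℤ.pos-* j (suc y)) ⟨
  + (a ℕ.+ j * suc y)                   ∎)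
  where open ≡-Reasoning

g-factor-even-k : ∀ {j y a} b .{{_ : NonZero a}} → δ-num (suc j) (suc y) ≡ + a →
  -1ℤ ℤ.^ j ≡ -1ℤ → b ℕ.+ j * suc y ≡ a → ∀ pr → g-factor (suc j) (suc y) pr ≡ + b / a
g-factor-even-k {j} {y} {a} b eq σ≡-1 b+jp≡a pr = g-factor-fraction {j} {y} {a} eq pr (begin
  + a ℤ.+ -1ℤ ℤ.^ j ℤ.* + j ℤ.* + suc y ≡⟨ cong (λ σ → + a ℤ.+ σ ℤ.* + j ℤ.* + suc y) σ≡-1 ⟩
  + a ℤ.+ -1ℤ ℤ.* + j ℤ.* + suc y       ≡⟨ cong (λ n → + a ℤ.+ n) (ℤ.*-assoc -1ℤ (+ j) (+ suc y)) ⟩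
  + a ℤ.+ -1ℤ ℤ.* (+ j ℤ.* + suc y)     ≡⟨ cong (λ n → + a ℤ.+ -1ℤ ℤ.* n) (ℤ.pos-* j (suc y)) ⟨
  + a ℤ.+ -1ℤ ℤ.* + m                   ≡⟨ cong (λ n → + a ℤ.+ n) (ℤ.-1*i≡-i (+ m)) ⟩
  + a ℤ.- + m                           ≡⟨ cong (λ n → + n ℤ.- + m) b+jp≡a ⟨
  + b ℤ.+ + m ℤ.- + m                   ≡⟨ ℤ.+-assoc (+ b) (+ m) (ℤ.- + m) ⟩
  + b ℤ.+ (+ m ℤ.- + m)                 ≡⟨ cong (λ n → + b ℤ.+ n) (ℤ.+-inverseʳ (+ m)) ⟩
  + b ℤ.+ ℤ.0ℤ                          ≡⟨ ℤ.+-identityʳ (+ b) ⟩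
  + b                                   ∎)
  where
  open ≡-Reasoning
  m = j * suc y

lead-1 : ∀ j → lead 1 j ≡ 2 ℕ.+ j
lead-1 j = cong₂ ℕ._+_ (ℕ.^-zeroˡ (suc j))
                       (trans (cong (suc j *_) (ℕ.^-zeroˡ j)) (ℕ.*-identityʳ (suc j)))

-- At y = 1 the numerator a is 2 for odd k and 2k for even k, so the factor is exactly k or 1/k.
g-factor-2-within : ∀ j .{{_ : NonZero j}} pr → Within (+ suc j / 1) (g-factor (suc j) 2 pr)
g-factor-2-within j pr with δ-num-natural j 1
... | a , eq , num@(odd-k σ≡1 a+j≡lead) =
  subst (Within (+ suc j / 1)) (sym (g-factor-odd-k {j} {1} {a} {{a≢0}} eq σ≡1 pr))
  (within-fractions (suc j) 1 (a ℕ.+ j * 2) a {{_}} {{a≢0}}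
    (ℕ.*-mono-≤ (s≤s (z≤n {j})) (ℕ.m≤m+n a (j * 2)))
    (ℕ.≤-reflexive (subst (λ a → (a ℕ.+ j * 2) * 1 ≡ suc j * a) (sym a≡2) (twice j))))
  where
  a≢0 : NonZero a
  a≢0 = ℕ.>-nonZero (numerator-positive num)
  a≡2 : a ≡ 2
  a≡2 = ℕ.+-cancelʳ-≡ j a 2 (trans a+j≡lead (lead-1 j))
  twice : ∀ j → (2 ℕ.+ j * 2) * 1 ≡ suc j * 2
  twice = solve-∀
... | a , eq , num@(even-k σ≡-1 a≡lead+j) =
  subst (Within (+ suc j / 1)) (sym (g-factor-even-k {j} {1} {a} 2 {{a≢0}} eq σ≡-1 (sym a≡) pr))
  (within-fractions (suc j) 1 2 a {{_}} {{a≢0}}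
    (ℕ.≤-reflexive (trans (cong (1 *_) a≡) (twice j)))
    (ℕ.≤-trans (subst (2 ≤_) (sym a≡) (ℕ.m≤m+n 2 (j * 2))) (ℕ.m≤n*m a (suc j))))
  where
  a≢0 : NonZero a
  a≢0 = ℕ.>-nonZero (numerator-positive num)
  sum : ∀ j → 2 ℕ.+ j ℕ.+ j ≡ 2 ℕ.+ j * 2
  sum = solve-∀
  a≡ : a ≡ 2 ℕ.+ j * 2
  a≡ = trans a≡lead+j (trans (cong (ℕ._+ j) (lead-1 j)) (sum j))
  twice : ∀ j → 1 * (2 ℕ.+ j * 2) ≡ suc j * 2
  twice = solve-∀

module _ {i z a : ℕ} where

  private
    j = 2 ℕ.+ i
    p = 3 ℕ.+ z
    u = p * (2 ℕ.+ z)
    v = (4 ℕ.+ z) * suc z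

    -- With y = p - 1 the right side of `lead-lower` allows y²(y + 3) = p² y + y(y - 1), and p u =
    -- p² y.
    j-bound : j * (p * u) ≤ 2 * lead (2 ℕ.+ z) j
    j-bound = ℕ.≤-trans (ℕ.*-monoʳ-≤ j pu≤) (lead-lower (2 ℕ.+ z) i (s≤s (s≤s z≤n)))
      where
      expand : ∀ z → let y = 2 ℕ.+ z in
        (3 ℕ.+ z) * ((3 ℕ.+ z) * y) ℕ.+ y * suc z ≡ y * y * (3 ℕ.+ y)
      expand = solve-∀
      pu≤ : p * u ≤ (2 ℕ.+ z) * (2 ℕ.+ z) * (5 ℕ.+ z)
      pu≤ = ℕ.≤-trans (ℕ.m≤m+n (p * u) _) (ℕ.≤-reflexive (expand z))

  -- As u = v + 2, the claim amounts to j p v ≤ 2a. From `j-bound`, j p u ≤ 2a + 2j, and passing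
  -- from u to v saves 2 j p ≥ 2j.
  odd-k-bound : a ℕ.+ j ≡ lead (2 ℕ.+ z) j → (a ℕ.+ j * p) * v ≤ u * a
  odd-k-bound a+j≡lead = ℕ.+-cancelʳ-≤ (j * (p * 2)) _ _ (begin
    (a ℕ.+ j * p) * v ℕ.+ j * (p * 2)  ≡⟨ collect a j p v ⟩
    a * v ℕ.+ j * (p * (v ℕ.+ 2))      ≡⟨ cong (λ n → a * v ℕ.+ j * (p * n)) (ω-gap z) ⟩
    a * v ℕ.+ j * (p * u)              ≤⟨ ℕ.+-monoʳ-≤ (a * v) j-bound ⟩
    a * v ℕ.+ 2 * lead (2 ℕ.+ z) j     ≡⟨ cong (λ n → a * v ℕ.+ 2 * n) a+j≡lead ⟨
    a * v ℕ.+ 2 * (a ℕ.+ j)            ≡⟨ expand a j v ⟩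
    (v ℕ.+ 2) * a ℕ.+ j * (1 * 2)
      ≤⟨ ℕ.+-monoʳ-≤ _ (ℕ.*-monoʳ-≤ j (ℕ.*-monoˡ-≤ 2 (s≤s (z≤n {2 ℕ.+ z})))) ⟩
    (v ℕ.+ 2) * a ℕ.+ j * (p * 2)      ≡⟨ cong (λ n → n * a ℕ.+ j * (p * 2)) (ω-gap z) ⟩
    u * a ℕ.+ j * (p * 2)              ∎)
    where
    open ℕ.≤-Reasoning
    collect : ∀ a j p v → (a ℕ.+ j * p) * v ℕ.+ j * (p * 2) ≡ a * v ℕ.+ j * (p * (v ℕ.+ 2))
    collect = solve-∀
    expand : ∀ a j v → a * v ℕ.+ 2 * (a ℕ.+ j) ≡ (v ℕ.+ 2) * a ℕ.+ j * (1 * 2)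
    expand = solve-∀

  even-k-bound : a ≡ lead (2 ℕ.+ z) j ℕ.+ j → j * (p * u) ≤ 2 * a
  even-k-bound refl = ℕ.≤-trans j-bound (ℕ.*-monoʳ-≤ 2 (ℕ.m≤m+n (lead (2 ℕ.+ z) j) j))

  -- Makes the truncated subtraction a - j p, the numerator of the factor for even k, exact.
  even-k-≤ : a ≡ lead (2 ℕ.+ z) j ℕ.+ j → j * p ≤ a
  even-k-≤ a≡ = ℕ.*-cancelˡ-≤ 2 (begin
    2 * (j * p)            ≡⟨ swap j p ⟩
    j * (p * 2)
      ≤⟨ ℕ.*-monoʳ-≤ j (ℕ.*-monoʳ-≤ p (ℕ.m+n≤o⇒n≤o v (ℕ.≤-reflexive (ω-gap z)))) ⟩
    j * (p * u)            ≤⟨ even-k-bound a≡ ⟩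
    2 * a                  ∎)
    where
    open ℕ.≤-Reasoning
    swap : ∀ j p → 2 * (j * p) ≡ j * (p * 2)
    swap = solve-∀

  -- Substituting a = b + j p and u = v + 2 turns the claim into j p u ≤ 2a.
  even-k-lower : ∀ b → b ℕ.+ j * p ≡ a → a ≡ lead (2 ℕ.+ z) j ℕ.+ j → v * a ≤ u * b
  even-k-lower b b+jp≡a a≡ = ℕ.+-cancelʳ-≤ (2 * (j * p)) _ _ (begin
    v * a ℕ.+ 2 * (j * p)                   ≡⟨ cong (λ n → v * n ℕ.+ 2 * (j * p)) b+jp≡a ⟨
    v * (b ℕ.+ j * p) ℕ.+ 2 * (j * p)       ≡⟨ collect b j p v ⟩
    v * b ℕ.+ j * (p * (v ℕ.+ 2))           ≡⟨ cong (λ n → v * b ℕ.+ j * (p * n)) (ω-gap z) ⟩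
    v * b ℕ.+ j * (p * u)                   ≤⟨ ℕ.+-monoʳ-≤ (v * b) (even-k-bound a≡) ⟩
    v * b ℕ.+ 2 * a                         ≡⟨ cong (λ n → v * b ℕ.+ 2 * n) b+jp≡a ⟨
    v * b ℕ.+ 2 * (b ℕ.+ j * p)             ≡⟨ expand b (j * p) v ⟩
    (v ℕ.+ 2) * b ℕ.+ 2 * (j * p)           ≡⟨ cong (λ n → n * b ℕ.+ 2 * (j * p)) (ω-gap z) ⟩
    u * b ℕ.+ 2 * (j * p)                   ∎)
    where
    open ℕ.≤-Reasoning
    collect : ∀ b j p v → v * (b ℕ.+ j * p) ℕ.+ 2 * (j * p) ≡ v * b ℕ.+ j * (p * (v ℕ.+ 2))
    collect = solve-∀
    expand : ∀ b m v → v * b ℕ.+ 2 * (b ℕ.+ m) ≡ (v ℕ.+ 2) * b ℕ.+ 2 * m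
    expand = solve-∀

-- The factor is at least 1 for odd k and at most 1 for even k, so in each case one of the two
-- bounds follows from `ω-≥1`.
g-factor-odd-within : ∀ i z pr → Within (ω z) (g-factor (3 ℕ.+ i) (3 ℕ.+ z) pr)
g-factor-odd-within i z pr with δ-num-natural (2 ℕ.+ i) (2 ℕ.+ z)
... | a , eq , num@(odd-k σ≡1 a+j≡lead) =
  subst (Within (ω z)) (sym (g-factor-odd-k {2 ℕ.+ i} {2 ℕ.+ z} {a} {{a≢0}} eq σ≡1 pr))
    (within-fractions u v b a {{_}} {{a≢0}}
      (ℕ.≤-trans (ℕ.*-monoʳ-≤ v (ℕ.m≤m+n a _)) (ℕ.*-monoˡ-≤ b (ω-≥1 z)))
      (odd-k-bound a+j≡lead))
  where
  a≢0 : NonZero a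
  a≢0 = ℕ.>-nonZero (numerator-positive num)
  u = (3 ℕ.+ z) * (2 ℕ.+ z)
  v = (4 ℕ.+ z) * suc z
  b = a ℕ.+ (2 ℕ.+ i) * (3 ℕ.+ z)
... | a , eq , num@(even-k σ≡-1 a≡) =
  subst (Within (ω z)) (sym (g-factor-even-k {2 ℕ.+ i} {2 ℕ.+ z} {a} b {{a≢0}} eq σ≡-1 b+jp≡a pr))
    (within-fractions u v b a {{_}} {{a≢0}}
      (even-k-lower b b+jp≡a a≡)
      (ℕ.≤-trans (ℕ.*-mono-≤ (ℕ.m∸n≤m a ((2 ℕ.+ i) * (3 ℕ.+ z))) (ω-≥1 z))
        (ℕ.≤-reflexive (ℕ.*-comm a u))))
  where
  a≢0 : NonZero a
  a≢0 = ℕ.>-nonZero (numerator-positive num)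
  u = (3 ℕ.+ z) * (2 ℕ.+ z)
  v = (4 ℕ.+ z) * suc z
  b = a ℕ.∸ (2 ℕ.+ i) * (3 ℕ.+ z)
  b+jp≡a : b ℕ.+ (2 ℕ.+ i) * (3 ℕ.+ z) ≡ a
  b+jp≡a = ℕ.m∸n+n≡m (even-k-≤ {i} {z} a≡)

g-bounds : ∀ i n .{{_ : NonZero n}} → let k = 3 ℕ.+ i in
  1ℚ < g k n ℚ.* (+ (2 * k) / 1) × g k n < + (2 * k) / 1
-- The induction over primes starts at 2; for n = 1 the product is empty.
g-bounds i 1 = subst (1ℚ <_) (sym (ℚ.*-identityˡ (+ (2 * k) / 1))) 1<2k , 1<2k
  where
  k = 3 ℕ.+ i
  1<2k : 1ℚ < + (2 * k) / 1
  1<2k = /-cross-< 1 1 (2 * k) 1 (s≤s (s≤s z≤n))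
g-bounds i n@(suc (suc m)) = subst₂ (λ q r → 1ℚ < q ℚ.* r × q < r)
  (sym (∏-filter (_∣? n) (primes≤ n) (g-factor k)))
  (trans (/-* (+ k) (+ 2) 1 1) (cong (_/ 1) (trans (sym (ℤ.pos-* k 2)) (cong +_ (ℕ.*-comm k 2)))))
  (∏-primes≤-bounds (λ p pr → if does (p ∣? n) then g-factor k p pr else 1ℚ)
    {{/-positive k 1}}
    (λ pr → within-if (does (2 ∣? n)) (within-1 k 1 (s≤s z≤n)) (g-factor-2-within (2 ℕ.+ i) pr))
    (λ z pr → within-if (does ((3 ℕ.+ z) ∣? n))
      (within-ω-1 z) (g-factor-odd-within i z pr))
    m)
  where
  k = 3 ℕ.+ i

-- Cauchy sequences of rationals

p≤∣p∣ : ∀ p → p ℚ.≤ ∣ p ∣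
p≤∣p∣ p with ℚ.≤-total 0ℚ p
... | inj₁ 0≤p = ℚ.≤-reflexive (sym (ℚ.0≤p⇒∣p∣≡p 0≤p))
... | inj₂ p≤0 = ℚ.≤-trans p≤0 (ℚ.0≤∣p∣ p)

p<q+r⇒p-q<r : ∀ p q r → p < q ℚ.+ r → p ℚ.- q < r
p<q+r⇒p-q<r p q r p<q+r = subst (p ℚ.- q <_) (cancel q r) (ℚ.+-monoˡ-< (ℚ.- q) p<q+r)
  where
  open +-*-Solver
  cancel : ∀ q r → q ℚ.+ r ℚ.- q ≡ r
  cancel = solve 2 (λ q r → q :+ r :- q := r) refl

∣p-q∣<r : ∀ p q r → p < q ℚ.+ r → q < p ℚ.+ r → ∣ p ℚ.- q ∣ < r
∣p-q∣<r p q r p<q+r q<p+r with ℚ.∣p∣≡p∨∣p∣≡-p (p ℚ.- q)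
... | inj₁ eq = subst (_< r) (sym eq) (p<q+r⇒p-q<r p q r p<q+r)
... | inj₂ eq = subst (_< r) (sym (trans eq (swap p q))) (p<q+r⇒p-q<r q p r q<p+r)
  where
  open +-*-Solver
  swap : ∀ p q → ℚ.- (p ℚ.- q) ≡ q ℚ.- p
  swap = solve 2 (λ p q → :- (p :- q) := q :- p) refl

antitone : ∀ {s : ℕ → ℚ} → (∀ N → s (suc N) ℚ.≤ s N) → ∀ {M N} → M ≤ N → s N ℚ.≤ s M
antitone {s} step M≤N = go (ℕ.≤⇒≤′ M≤N)
  where
  go : ∀ {M N} → M ℕ.≤′ N → s N ℚ.≤ s M
  go (ℕ.≤′-reflexive refl) = ℚ.≤-refl
  go (ℕ.≤′-step {N} M≤′N) = ℚ.≤-trans (step N) (go M≤′N)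

-- By monotonicity all terms from M on are at most s M, so a one-sided estimate traps them in an
-- interval of length ε.
antitone⇒cauchy : ∀ {s} → (∀ N → s (suc N) ℚ.≤ s N) →
  (∀ ε → 0ℚ < ε → ∃[ M ] (∀ N → M ≤ N → s M < s N ℚ.+ ε)) → Cauchy s
antitone⇒cauchy {s} step close ε 0<ε with close ε 0<ε
... | M , near = M , λ m n M≤m M≤n →
  ∣p-q∣<r (s m) (s n) ε (ℚ.≤-<-trans (antitone {s} step M≤m) (near n M≤n))
          (ℚ.≤-<-trans (antitone {s} step M≤n) (near m M≤m))

cauchy⇒⟶ : ∀ s (c : Cauchy s) → s ⟶ mkℝ s c
cauchy⇒⟶ s c ε 0<ε = N , λ n N≤n →
  (h , 0<h , N , λ m N≤m → below (s n) (s m) (near n m N≤n N≤m)) ,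
  (h , 0<h , N , λ m N≤m → above (s n) (s m) (near m n N≤m N≤n))
  where
  -- One half of ε bounds the distance between terms, the other half is the uniform gap that `_<ℝ_`
  -- demands.
  h = ½ ℚ.* ε
  0<h : 0ℚ < h
  0<h = subst (_< h) (ℚ.*-zeroʳ ½) (ℚ.*-monoʳ-<-pos ½ 0<ε)
  N = proj₁ (c h 0<h)
  near : ∀ m n → N ≤ m → N ≤ n → s m ℚ.- s n ℚ.≤ h
  near m n N≤m N≤n = ℚ.≤-trans (p≤∣p∣ _) (ℚ.<⇒≤ (proj₂ (c h 0<h) m n N≤m N≤n))
  open +-*-Solver
  below-left : ∀ x y e → (x ℚ.- y) ℚ.+ (y ℚ.- ½ ℚ.* e) ≡ x ℚ.- e ℚ.+ ½ ℚ.* e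
  below-left = solve 3 (λ x y e → (x :- y) :+ (y :- con ½ :* e) := x :- e :+ con ½ :* e) refl
  below-right : ∀ y h → h ℚ.+ (y ℚ.- h) ≡ y
  below-right = solve 2 (λ y h → h :+ (y :- h) := y) refl
  below : ∀ x y → x ℚ.- y ℚ.≤ h → x ℚ.- ε ℚ.+ h ℚ.≤ y
  below x y le = subst₂ ℚ._≤_ (below-left x y ε) (below-right y h) (ℚ.+-monoˡ-≤ (y ℚ.- h) le)
  above-left : ∀ x y h → (y ℚ.- x) ℚ.+ (x ℚ.+ h) ≡ y ℚ.+ h
  above-left = solve 3 (λ x y h → (y :- x) :+ (x :+ h) := y :+ h) refl
  above-right : ∀ x e → ½ ℚ.* e ℚ.+ (x ℚ.+ ½ ℚ.* e) ≡ x ℚ.+ e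
  above-right = solve 2 (λ x e → con ½ :* e :+ (x :+ con ½ :* e) := x :+ e) refl
  above : ∀ x y → y ℚ.- x ℚ.≤ h → y ℚ.+ h ℚ.≤ x ℚ.+ ε
  above x y le = subst₂ ℚ._≤_ (above-left x y h) (above-right x ε) (ℚ.+-monoˡ-≤ (x ℚ.+ h) le)

archimedean : ∀ ε → 0ℚ < ε → ∃[ b ] (1ℤ / suc b ℚ.≤ ε)
archimedean ε@(ℚ.mkℚ (+ suc a) b _) _ = b , subst (1ℤ / suc b ℚ.≤_) (ℚ.↥p/↧p≡p ε)
  (/-cross-≤ 1 (suc b) (suc a) (suc b) (ℕ.*-monoˡ-≤ (suc b) (s≤s (z≤n {a}))))
archimedean (ℚ.mkℚ (+ 0) b _) (ℚ.*<* (ℤ.+<+ ()))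
archimedean (ℚ.mkℚ (ℤ.-[1+ a ]) b _) (ℚ.*<* ())

-- The product D_k

module _ (i : ℕ) where

  private
    k = 3 ℕ.+ i
    d = deficit i
    c = suc d

    s : ℕ → ℚ
    s = D-partial k

    -- `τ` is 1 - `η`; once N ≥ d² it bounds the fraction of the partial product that later factors
    -- can still remove.
    η τ : ℕ → ℚ
    η N = + N / (c ℕ.+ N)
    τ N = + c / (c ℕ.+ N)

  D-factor-natural : ∀ z pr → let p = 2 ℕ.+ z in
    ∃[ a ] (D-factor k p pr ≡ _/_ (+ a) (p ^ k) {{ℕ.m^n≢0 p k}} × Numerator (2 ℕ.+ i) (suc z) a)
  D-factor-natural z pr =
    let a , eq , num = δ-num-natural (2 ℕ.+ i) (suc z) in
    a , D-factor-fraction {2 ℕ.+ i} {suc z} {a} eq pr {{ℕ.m^n≢0 (2 ℕ.+ z) k}} , num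

  D-factor-positive : ∀ y pr → ℚ.Positive (D-factor k (suc y) pr)
  D-factor-positive zero    pr = contradiction pr ¬prime[1]
  D-factor-positive (suc z) pr =
    let a , eq , num = D-factor-natural z pr in
    subst ℚ.Positive (sym eq)
      (/-positive a ((2 ℕ.+ z) ^ k)
        {{ℕ.>-nonZero (numerator-positive num)}} {{ℕ.m^n≢0 (2 ℕ.+ z) k}})

  D-factor<1 : ∀ y pr → D-factor k (suc y) pr < 1ℚ
  D-factor<1 zero    pr = contradiction pr ¬prime[1]
  D-factor<1 (suc z) pr =
    let a , eq , num = D-factor-natural z pr in
    subst (_< 1ℚ) (sym eq)
      (/-cross-< a P 1 1 {{ℕ.m^n≢0 (2 ℕ.+ z) k}}
        (subst₂ ℕ._<_ (sym (ℕ.*-identityʳ a)) (sym (ℕ.*-identityˡ P)) (numerator-upper num)))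
    where P = (2 ℕ.+ z) ^ k

  D-factor-telescope : ∀ y pr → d * d ≤ suc y → η y ℚ.≤ D-factor k (suc y) pr ℚ.* η (suc y)
  D-factor-telescope zero    pr _ = contradiction pr ¬prime[1]
  D-factor-telescope (suc z) pr d²≤p =
    let a , eq , num = D-factor-natural z pr in
    subst (η y ℚ.≤_)
      (sym (trans (cong (ℚ._* η p) eq)
        (trans (/-* (+ a) (+ p) P (c ℕ.+ p) {{ℕ.m^n≢0 p k}})
               (cong (λ n → _/_ n (P * (c ℕ.+ p)) {{nz}}) (sym (ℤ.pos-* a p))))))
      (/-cross-≤ y (c ℕ.+ y) (a * p) (P * (c ℕ.+ p)) {{_}} {{nz}} (numerator-telescope d²≤p num))
    where
    y = suc z
    p = suc y
    P = p ^ k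
    nz : NonZero (P * (c ℕ.+ p))
    nz = ℕ.m*n≢0 P (c ℕ.+ p) {{ℕ.m^n≢0 p k}}

  -- Covers the steps to non-primes, where the partial product is unchanged and only `η` moves.
  η-mono : ∀ y → η y ℚ.≤ η (suc y)
  η-mono y = /-cross-≤ y (c ℕ.+ y) (suc y) (c ℕ.+ suc y)
    (ℕ.≤-trans (ℕ.m≤m+n _ c) (ℕ.≤-reflexive (expand y c)))
    where
    expand : ∀ y c → y * (c ℕ.+ suc y) ℕ.+ c ≡ suc y * (c ℕ.+ y)
    expand = solve-∀

  η≤1 : ∀ y → η y ℚ.≤ 1ℚ
  η≤1 y = /-cross-≤ y (c ℕ.+ y) 1 1
    (subst₂ _≤_ (sym (ℕ.*-identityʳ y)) (sym (ℕ.*-identityˡ (c ℕ.+ y))) (ℕ.m≤n+m y c))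

  η+τ≡1 : ∀ y → η y ℚ.+ τ y ≡ 1ℚ
  η+τ≡1 y = trans (/-+ (+ y) (+ c) (c ℕ.+ y)) (/-cross-≡ (y ℕ.+ c) (c ℕ.+ y) 1 1 (swap y c))
    where
    swap : ∀ y c → (y ℕ.+ c) * 1 ≡ 1 * (c ℕ.+ y)
    swap = solve-∀

  D-partial-positive : ∀ N → ℚ.Positive (s N)
  D-partial-positive zero    = _
  D-partial-positive (suc N) = ∏-primes≤-suc (D-factor k) N ℚ.Positive
    (λ pr → ℚ.pos*pos⇒pos (s N) {{D-partial-positive N}}
              (D-factor k (suc N) pr) {{D-factor-positive N pr}})
    (λ _ → D-partial-positive N)

  D-partial-antitone : ∀ N → s (suc N) ℚ.≤ s N
  D-partial-antitone N = ∏-primes≤-suc (D-factor k) N (ℚ._≤ s N)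
    (λ pr → subst (s N ℚ.* D-factor k (suc N) pr ℚ.≤_) (ℚ.*-identityʳ (s N))
      (ℚ.*-monoˡ-≤-nonNeg (s N) {{ℚ.pos⇒nonNeg (s N) {{D-partial-positive N}}}}
        (ℚ.<⇒≤ (D-factor<1 N pr))))
    (λ _ → ℚ.≤-refl)

  D-partial-≤1 : ∀ N → s N ℚ.≤ 1ℚ
  D-partial-≤1 N = antitone {s} D-partial-antitone {0} {N} z≤n

  -- The factor at 2 alone provides a gap below 1 that is the same for all later partial products.
  D-partial-2<1 : s 2 < 1ℚ
  D-partial-2<1 = ∏-primes≤-suc (D-factor k) 1 (_< 1ℚ)
    (λ pr → subst (_< 1ℚ) (sym (ℚ.*-identityˡ (D-factor k 2 pr))) (D-factor<1 1 pr))
    (λ ¬pr → contradiction prime[2] ¬pr)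

  D-partial-η-step : ∀ N → d * d ≤ suc N → s N ℚ.* η N ℚ.≤ s (suc N) ℚ.* η (suc N)
  D-partial-η-step N d²≤p = ∏-primes≤-suc (D-factor k) N (λ q → s N ℚ.* η N ℚ.≤ q ℚ.* η (suc N))
    (λ pr → subst (s N ℚ.* η N ℚ.≤_) (sym (ℚ.*-assoc (s N) (D-factor k (suc N) pr) (η (suc N))))
      (mono (D-factor-telescope N pr d²≤p)))
    (λ _ → mono (η-mono N))
    where
    mono : ∀ {q r} → q ℚ.≤ r → s N ℚ.* q ℚ.≤ s N ℚ.* r
    mono = ℚ.*-monoˡ-≤-nonNeg (s N) {{ℚ.pos⇒nonNeg (s N) {{D-partial-positive N}}}}

  -- From d² on the products with `η` increase, and `η` ≤ 1 removes it at N. This serves both the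
  -- Cauchy property and the positivity of the limit.
  D-partial-lower : ∀ {M N} → d * d ≤ M → M ≤ N → s M ℚ.* η M ℚ.≤ s N
  D-partial-lower {M} {N} d²≤M M≤N = ℚ.≤-trans (go (ℕ.≤⇒≤′ M≤N))
    (subst (s N ℚ.* η N ℚ.≤_) (ℚ.*-identityʳ (s N))
      (ℚ.*-monoˡ-≤-nonNeg (s N) {{ℚ.pos⇒nonNeg (s N) {{D-partial-positive N}}}} (η≤1 N)))
    where
    go : ∀ {N} → M ℕ.≤′ N → s M ℚ.* η M ℚ.≤ s N ℚ.* η N
    go (ℕ.≤′-reflexive refl) = ℚ.≤-refl
    go (ℕ.≤′-step {N} M≤′N) = ℚ.≤-trans (go M≤′N)
      (D-partial-η-step N (ℕ.≤-trans d²≤M (ℕ.≤-trans (ℕ.≤′⇒≤ M≤′N) (ℕ.n≤1+n N))))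

  D-partial-cauchy : Cauchy s
  D-partial-cauchy = antitone⇒cauchy {s} D-partial-antitone close
    where
    close : ∀ ε → 0ℚ < ε → ∃[ M ] (∀ N → M ≤ N → s M < s N ℚ.+ ε)
    close ε 0<ε with archimedean ε 0<ε
    ... | b , 1/b≤ε = M , λ N M≤N → begin-strict
      s M                               ≡⟨ ℚ.*-identityʳ (s M) ⟨
      s M ℚ.* 1ℚ                        ≡⟨ cong (s M ℚ.*_) (η+τ≡1 M) ⟨
      s M ℚ.* (η M ℚ.+ τ M)             ≡⟨ ℚ.*-distribˡ-+ (s M) (η M) (τ M) ⟩
      s M ℚ.* η M ℚ.+ s M ℚ.* τ M
        ≤⟨ ℚ.+-mono-≤ (D-partial-lower (ℕ.m≤m+n (d * d) (c * suc b)) M≤N)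
             (ℚ.*-monoʳ-≤-nonNeg (τ M) {{τ-nonNeg}} (D-partial-≤1 M)) ⟩
      s N ℚ.+ 1ℚ ℚ.* τ M                ≡⟨ cong (s N ℚ.+_) (ℚ.*-identityˡ (τ M)) ⟩
      s N ℚ.+ τ M                       <⟨ ℚ.+-monoʳ-< (s N) τ<ε ⟩
      s N ℚ.+ ε                         ∎
      where
      open ℚ.≤-Reasoning
      -- The summand d² reaches the range of `D-partial-lower`; the summand c (b + 1) makes τ M =
      -- c/(c + M) smaller than 1/(b + 1).
      M = d * d ℕ.+ c * suc b
      τ-nonNeg : ℚ.NonNegative (τ M)
      τ-nonNeg = ℚ.normalize-nonNeg c (c ℕ.+ M)
      τ<ε : τ M < ε
      τ<ε = ℚ.<-≤-trans (/-cross-< c (c ℕ.+ M) 1 (suc b)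
        (subst (c * suc b ℕ.<_) (sym (ℕ.*-identityˡ (c ℕ.+ M)))
          (s≤s (ℕ.≤-trans (ℕ.m≤n+m (c * suc b) (d * d)) (ℕ.m≤n+m M d))))) 1/b≤ε

  D-partial-limit : ∃[ D ] (D-partial k ⟶ D × fromℚ 0ℚ <ℝ D × D <ℝ fromℚ 1ℚ)
  D-partial-limit = mkℝ s D-partial-cauchy , cauchy⇒⟶ s D-partial-cauchy ,
    (s M ℚ.* η M , 0<sη , M , λ N M≤N →
      subst (ℚ._≤ s N) (sym (ℚ.+-identityˡ _)) (D-partial-lower (ℕ.n≤1+n (d * d)) M≤N)) ,
    (1ℚ ℚ.- s 2 , 0<1-s₂ , 2 , λ N 2≤N →
      subst (s N ℚ.+ (1ℚ ℚ.- s 2) ℚ.≤_) (cancel (s 2))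
        (ℚ.+-monoˡ-≤ (1ℚ ℚ.- s 2) (antitone {s} D-partial-antitone {2} {N} 2≤N)))
    where
    open +-*-Solver
    -- The successor makes M, and with it η M, evidently nonzero.
    M = suc (d * d)
    0<sη : 0ℚ < s M ℚ.* η M
    0<sη = ℚ.positive⁻¹ _
      {{ℚ.pos*pos⇒pos (s M) {{D-partial-positive M}} (η M) {{/-positive M (c ℕ.+ M)}}}}
    0<1-s₂ : 0ℚ < 1ℚ ℚ.- s 2
    0<1-s₂ = subst (_< 1ℚ ℚ.- s 2) (ℚ.+-inverseʳ (s 2)) (ℚ.+-monoˡ-< (ℚ.- s 2) D-partial-2<1)
    cancel : ∀ q → q ℚ.+ (1ℚ ℚ.- q) ≡ 1ℚ
    cancel = solve 1 (λ q → q :+ (con 1ℚ :- q) := con 1ℚ) refl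

-- Turns the product form, in which the lower bounds on `g` were multiplied together, into a bound
-- by 1/(2k).
reciprocal-< : ∀ m q .{{_ : NonZero m}} → 1ℚ < q ℚ.* (+ m / 1) → 1ℤ / m < q
reciprocal-< m q 1<qm = ℚ.*-cancelʳ-<-nonNeg (+ m / 1) {{ℚ.normalize-nonNeg m 1}} {1ℤ / m} {q}
  (subst (_< q ℚ.* (+ m / 1)) (sym inverse) 1<qm)
  where
  inverse : 1ℤ / m ℚ.* (+ m / 1) ≡ 1ℚ
  inverse = trans (ℚ.*-comm (1ℤ / m) (+ m / 1)) (trans (/-*ˡ (+ m) 1ℤ m)
    (trans (cong (_/ m) (ℤ.*-identityʳ (+ m))) (/-cross-≡ m m 1 1 (ℕ.*-comm m 1))))

theorem5 : (∀ k .{{_ : NonZero k}} → 3 ≤ k →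
    ∃[ D ] (D-partial k ⟶ D × fromℚ 0ℚ <ℝ D × D <ℝ fromℚ 1ℚ))
    ×
    (∀ k .{{_ : NonZero k}} → 3 ≤ k → ∀ n .{{_ : NonZero n}} →
    _/_ 1ℤ (2 * k) {{m*n≢0 2 k}} < g k n × g k n < + (2 * k) / 1)
theorem5 =
  (λ { (suc (suc (suc i))) _ → D-partial-limit i
     ; 1 (s≤s ()) ; 2 (s≤s (s≤s ())) }) ,
  (λ { (suc (suc (suc i))) _ n → let 1<g*2k , g<2k = g-bounds i n in
         reciprocal-< (2 * (3 ℕ.+ i)) (g (3 ℕ.+ i) n) 1<g*2k , g<2k
     ; 1 (s≤s ()) ; 2 (s≤s (s≤s ())) })
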